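{- Let $H$ be a finite $3$-uniform hypergraph on $n$ vertices that is $f_0$-sparse, where $f_0(k)=\lceil k/2\rceil$; that is, for every $k\in\{4,5,\dots,n\}$, every $k$-element set of vertices contains at most $\lceil k/2\rceil$ hyperedges. Then $H$ is metric.
   Context: Given a metric space $M=(X,\rho)$ and three distinct points $x,y,z\in X$, $y$ is said to be between $x$ and $z$ if $\rho(x,z)=\rho(x,y)+\rho(y,z)$; the triple $\{x,y,z\}$ is collinear if one of its points is between the other two. The hypergraph $H_M$ associated with $M$ is the $3$-uniform hypergraph whose vertices are the points of $M$ and whose hyperedges are exactly the collinear triples of $M$. A $3$-uniform hypergraph $H$ is metric if there is a metric space $M$ with $H_M=H$. A set $X$ of vertices contains (induces) a hyperedge $e$ if $e\subseteq X$. -}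

module Defs where

open import Data.Nat using (ℕ; _≤_; ⌈_/2⌉)
open import Data.Fin using (Fin)
open import Data.Fin.Subset using (Subset; ∣_∣; ⁅_⁆; _∪_; _⊆_)
open import Data.Fin.Subset.Properties using (_⊆?_)
open import Data.List using (List; length; filter)
open import Data.List.Relation.Unary.All using (All)
open import Data.List.Relation.Unary.Unique.Propositional using (Unique)
open import Data.List.Membership.Propositional using (_∈_)
open import Data.Rational using (ℚ; 0ℚ) renaming (_≤_ to _≤ℚ_; _+_ to _+ℚ_)
open import Data.Product using (_×_; Σ)
open import Data.Sum using (_⊎_)
open import Relation.Binary.PropositionalEquality using (_≡_; _≢_)
open import Relation.Nullary using (¬_)
open import Function.Bundles using (_⇔_)

record Hypergraph3 (n : ℕ) : Set where
  field
    edges   : List (Subset n)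
    unique  : Unique edges
    uniform : All (λ e → ∣ e ∣ ≡ 3) edges
open Hypergraph3 public

triple : ∀ {n} → Fin n → Fin n → Fin n → Subset n
triple x y z = ⁅ x ⁆ ∪ (⁅ y ⁆ ∪ ⁅ z ⁆)

edgesIn : ∀ {n} → Hypergraph3 n → Subset n → ℕ
edgesIn H S = length (filter (_⊆? S) (edges H))

Sparse : ∀ {n} → (ℕ → ℕ) → Hypergraph3 n → Set
Sparse {n} f H = ∀ (S : Subset n) → 4 ≤ ∣ S ∣ → edgesIn H S ≤ f ∣ S ∣

f₀ : ℕ → ℕ
f₀ k = ⌈ k /2⌉

record IsMetric {n : ℕ} (ρ : Fin n → Fin n → ℚ) : Set where
  field
    nonneg   : ∀ x y → 0ℚ ≤ℚ ρ x y
    zero⇔eq  : ∀ x y → ρ x y ≡ 0ℚ ⇔ x ≡ y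
    symm     : ∀ x y → ρ x y ≡ ρ y x
    triangle : ∀ x y z → ρ x z ≤ℚ ρ x y +ℚ ρ y z

Between : ∀ {n} → (Fin n → Fin n → ℚ) → Fin n → Fin n → Fin n → Set
Between ρ x y z = ρ x z ≡ ρ x y +ℚ ρ y z

Collinear : ∀ {n} → (Fin n → Fin n → ℚ) → Fin n → Fin n → Fin n → Set
Collinear ρ x y z = Between ρ x y z ⊎ (Between ρ y x z ⊎ Between ρ x z y)

Distinct3 : ∀ {n} → Fin n → Fin n → Fin n → Set
Distinct3 x y z = x ≢ y × (y ≢ z × x ≢ z)

Realizes : ∀ {n} → (Fin n → Fin n → ℚ) → Hypergraph3 n → Set
Realizes ρ H = ∀ x y z → Distinct3 x y z → (triple x y z ∈ edges H ⇔ Collinear ρ x y z)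

IsMetricHypergraph : ∀ {n} → Hypergraph3 n → Set
IsMetricHypergraph {n} H = Σ (Fin n → Fin n → ℚ) (λ ρ → IsMetric ρ × Realizes ρ H)

{-# OPTIONS --safe #-}

-- Sparseness has two consequences.  Every edge has a pair of vertices lying in no other edge, since
-- otherwise there would be four edges on at most six vertices; and, by counting incidences, every
-- nonempty vertex set S contains a vertex lying in at most one edge inside S.  Hence a metric can be
-- built by adding vertices one at a time, each in at most one edge {v, x, y} with the vertices
-- already present, always making a pair private to the edge the long side of the new collinear
-- triple.  If the long side is vy, nothing old lies between x and y, because xy would then be the
-- long side of another edge and yet lie in {v, x, y}; so v can be put far away on the line beyond x.
-- If it is xy, no old triple through x and y is collinear, and v can be put between them, close to
-- x.  All other triangles involving v can be kept strict.  Distances are natural numbers and are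
-- scaled up before each step, so that every strict inequality acquires a large slack.
module Submission where

open import Defs
open import Data.Bool using () renaming (_≟_ to _≟ᵇ_)
open import Data.Fin using (Fin; zero; suc)
open import Data.Fin.Properties using (_≟_; any?)
open import Data.Fin.Subset using (Subset; Nonempty; ⊤; ∣_∣; ⁅_⁆; _∪_; _-_; _∈_; _∉_; _⊆_; inside; outside)
open import Data.Fin.Subset.Properties
import Data.Integer as ℤ
import Data.Integer.Properties as ℤ
open import Data.List using (List; []; _∷_; _++_; length; map; filter)
open import Data.List.Membership.Propositional using (find; lose) renaming (_∈_ to _∈ˡ_)
open import Data.List.Membership.Propositional.Properties using (∈-filter⁺; ∈-∃++; ∈-++⁺ˡ; ∈-++⁺ʳ; ∈-++⁻)
import Data.List.Properties as List
open import Data.List.Relation.Unary.All using (All; []; _∷_)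
import Data.List.Relation.Unary.All as All
import Data.List.Relation.Unary.All.Properties as All
open import Data.List.Relation.Unary.AllPairs using ([]; _∷_)
open import Data.List.Relation.Unary.Any using (here; there)
import Data.List.Relation.Unary.Any as Any
open import Data.List.Relation.Unary.Unique.Propositional using (Unique)
open import Data.Nat using (ℕ; zero; suc; _+_; _*_; _∸_; _≤_; _<_; z≤n; s≤s; z<s; ⌈_/2⌉; ⌊_/2⌋; _≤?_)
import Data.Nat.Coprimality as Coprime
open import Data.Nat.ListAction using (sum)
open import Data.Nat.Properties hiding (_≟_)
open import Data.Product using (_×_; _,_; proj₁; proj₂; ∃; ∃₂)
open import Data.Rational using (ℚ; mkℚ; *≤*) renaming (_+_ to _+ℚ_; _≤_ to _≤ℚ_)
import Data.Rational as ℚ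
open import Data.Rational.Properties using (toℚᵘ-injective; toℚᵘ-homo-+)
open import Data.Rational.Unnormalised using (*≡*)
import Data.Rational.Unnormalised.Properties as ℚᵘ
open import Data.Sum using (_⊎_; inj₁; inj₂; [_,_]′)
import Data.Sum as Sum
open import Data.Vec using ([]; _∷_; tail; here; there)
open import Data.Vec.Properties using (≡-dec)
open import Function using (_∘_)
open import Function.Bundles using (mk⇔)
open import Relation.Binary.PropositionalEquality
open import Relation.Nullary using (¬_; Dec; yes; no; contradiction; ¬?; _×-dec_)
open import Relation.Nullary.Decidable using (decidable-stable)
open import Algebra.Properties.CommutativeSemigroup +-commutativeSemigroup using (x∙yz≈y∙xz)
open ≤-Reasoning

private variable
  n : ℕ

-- Bounds for functions on finite sets.

dominated : ∀ {n} (f : Fin n → ℕ) → ∃ λ m → ∀ i → f i ≤ m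
dominated {zero}  f = 0 , λ ()
dominated {suc n} f with dominated (f ∘ suc)
... | m , f≤m = f zero + m , λ where
  zero    → m≤m+n (f zero) m
  (suc i) → ≤-trans (f≤m i) (m≤n+m m (f zero))

dominated₂ : ∀ {n} (d : Fin n → Fin n → ℕ) → ∃ λ m → ∀ x y → d x y ≤ m
dominated₂ d with dominated (λ x → proj₁ (dominated (d x)))
... | m , h = m , λ x y → ≤-trans (proj₂ (dominated (d x)) y) (h x)

-- One-point extensions of metrics with natural-number distances.

module Extension {n : ℕ} (Edge : Fin n → Fin n → Fin n → Set)
  (swap₁₂ : ∀ {x y z} → Edge x y z → Edge y x z)
  (swap₂₃ : ∀ {x y z} → Edge x y z → Edge x z y) where

  Private : Fin n → Fin n → Fin n → Set
  Private x y z = ∀ w → w ≢ x → w ≢ z → Edge x w z → w ≡ y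

  -- The collinear triples that a construction may produce: the long side `xz` must lie in no other
  -- edge. Maintaining this is what leaves room for later vertices.
  Mid : Fin n → Fin n → Fin n → Set
  Mid x y z = Edge x y z × Private x y z

  reverse : ∀ {x y z} → Edge x y z → Edge z y x
  reverse = swap₁₂ ∘ swap₂₃ ∘ swap₁₂

  Mid-sym : ∀ {x y z} → Mid x y z → Mid z y x
  Mid-sym (e , p) = reverse e , λ w w≢z w≢x → p w w≢x w≢z ∘ reverse

  infix 4 _≼_by_
  -- An inequality whose equality case carries a reason, so that one statement gives both the
  -- triangle inequality and control over collinearity.
  _≼_by_ : ℕ → ℕ → Set → Set
  a ≼ b by P = a < b ⊎ (a ≡ b × P)

  ≼⇒≤ : ∀ {a b P} → a ≼ b by P → a ≤ b
  ≼⇒≤ (inj₁ a<b)       = <⇒≤ a<b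
  ≼⇒≤ (inj₂ (refl , _)) = ≤-refl

  ≼-strict : ∀ {a b P} → ¬ P → a ≼ b by P → a < b
  ≼-strict ¬p (inj₁ a<b)     = a<b
  ≼-strict ¬p (inj₂ (_ , p)) = contradiction p ¬p

  ≼-scale : ∀ k b c {a P} → a ≼ b + c by P → suc k * a ≼ suc k * b + suc k * c by P
  ≼-scale k b c {a} (inj₁ a<b+c) = inj₁ (begin-strict
    suc k * a              <⟨ *-monoʳ-< (suc k) a<b+c ⟩
    suc k * (b + c)        ≡⟨ *-distribˡ-+ (suc k) b c ⟩
    suc k * b + suc k * c  ∎)
  ≼-scale k b c {a} (inj₂ (refl , p)) = inj₂ (*-distribˡ-+ (suc k) b c , p)

  Line : (Fin n → Fin n → ℕ) → Fin n → Fin n → Fin n → Set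
  Line d x y z = d x z ≡ d x y + d y z ⊎ (d y z ≡ d y x + d x z ⊎ d x y ≡ d x z + d z y)

  module _ {d : Fin n → Fin n → ℕ} (d-sym : ∀ x y → d x y ≡ d y x) where

    flip-sum : ∀ {a} x y z → a ≡ d x y + d y z → a ≡ d z y + d y x
    flip-sum x y z eq =
      trans eq (trans (+-comm (d x y) (d y z)) (cong₂ _+_ (d-sym y z) (d-sym x y)))

    Line-swap₁₂ : ∀ x y z → Line d x y z → Line d y x z
    Line-swap₁₂ x y z (inj₁ p)        = inj₂ (inj₁ p)
    Line-swap₁₂ x y z (inj₂ (inj₁ p)) = inj₁ p
    Line-swap₁₂ x y z (inj₂ (inj₂ p)) = inj₂ (inj₂ (trans (d-sym y x) (flip-sum x z y p)))

    Line-swap₂₃ : ∀ x y z → Line d x y z → Line d x z y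
    Line-swap₂₃ x y z (inj₁ p)        = inj₂ (inj₂ p)
    Line-swap₂₃ x y z (inj₂ (inj₁ p)) = inj₂ (inj₁ (trans (d-sym z y) (flip-sum y x z p)))
    Line-swap₂₃ x y z (inj₂ (inj₂ p)) = inj₁ p

  -- `triangle` permits equality only at `Mid` triples and `line` forces it for every edge, so
  -- inside `S` the collinear triples are exactly the edges.
  record Realization (S : Fin n → Set) (d : Fin n → Fin n → ℕ) : Set where
    field
      d-sym    : ∀ x y → d x y ≡ d y x
      d-refl   : ∀ x → d x x ≡ 0
      d-pos    : ∀ {x y} → S x → S y → x ≢ y → 0 < d x y
      triangle : ∀ {x y z} → S x → S y → S z → x ≢ y → y ≢ z → x ≢ z →
                 d x z ≼ d x y + d y z by Mid x y z
      line     : ∀ {x y z} → S x → S y → S z → x ≢ y → y ≢ z → x ≢ z →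
                 Edge x y z → Line d x y z

    Δ : ∀ {x y z} → S x → S y → S z → d x z ≤ d x y + d y z
    Δ {x} {y} {z} x∈ y∈ z∈ with x ≟ y | y ≟ z | x ≟ z
    ... | yes refl | _        | _        = m≤n+m _ _
    ... | no _     | yes refl | _        = m≤m+n _ _
    ... | no _     | no _     | yes refl = ≤-trans (≤-reflexive (d-refl x)) z≤n
    ... | no p     | no q     | no r     = ≼⇒≤ (triangle x∈ y∈ z∈ p q r)

  module _ {S T : Fin n → Set} {d : Fin n → Fin n → ℕ} (R : Realization T d)
    (v : Fin n) (S⇒T : ∀ {x} → S x → x ≢ v → T x) (k : ℕ) (f : Fin n → ℕ) where
    open Realization R

    -- Scaling by the positive factor `suc k` preserves the old equalities and widens the old strict
    -- inequalities, making room for the distances `f` from `v`.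
    extend : Fin n → Fin n → ℕ
    extend x y with x ≟ v | y ≟ v
    ... | yes _ | yes _ = 0
    ... | yes _ | no _  = f y
    ... | no _  | yes _ = f x
    ... | no _  | no _  = suc k * d x y

    extend-sym : ∀ x y → extend x y ≡ extend y x
    extend-sym x y with x ≟ v | y ≟ v
    ... | yes _ | yes _ = refl
    ... | yes _ | no _  = refl
    ... | no _  | yes _ = refl
    ... | no _  | no _  = cong (suc k *_) (d-sym x y)

    extend-refl : ∀ x → extend x x ≡ 0
    extend-refl x with x ≟ v
    ... | yes _ = refl
    ... | no _  = trans (cong (suc k *_) (d-refl x)) (*-zeroʳ (suc k))

    -- Triples avoiding `v` are inherited by scaling. For the others, `outer` has `v` as an
    -- endpoint, `inner` has it in the middle, and `collinear` has it first; the symmetries of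
    -- `extend` and `Edge` supply the remaining positions.
    realization-extend :
      (∀ {z} → T z → 0 < f z) →
      (∀ {z w} → T z → T w → z ≢ v → w ≢ v → z ≢ w → f w ≼ f z + suc k * d z w by Mid v z w) →
      (∀ {z w} → T z → T w → z ≢ v → w ≢ v → z ≢ w → suc k * d z w ≼ f z + f w by Mid z v w) →
      (∀ {z w} → T z → T w → z ≢ v → w ≢ v → z ≢ w → Edge v z w →
         f w ≡ f z + suc k * d z w ⊎ (suc k * d z w ≡ f z + f w ⊎ f z ≡ f w + suc k * d w z)) →
      Realization S extend
    realization-extend f-pos outer inner collinear = record
      { d-sym = extend-sym
      ; d-refl = extend-refl
      ; d-pos = pos
      ; triangle = tri
      ; line = ln
      }
      where
      pos : ∀ {x y} → S x → S y → x ≢ y → 0 < extend x y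
      pos {x} {y} x∈ y∈ x≢y with x ≟ v | y ≟ v
      ... | yes refl | yes refl = contradiction refl x≢y
      ... | yes _    | no y≢v   = f-pos (S⇒T y∈ y≢v)
      ... | no x≢v   | yes _    = f-pos (S⇒T x∈ x≢v)
      ... | no x≢v   | no y≢v   = <-≤-trans (d-pos (S⇒T x∈ x≢v) (S⇒T y∈ y≢v) x≢y) (m≤m+n _ _)

      tri : ∀ {x y z} → S x → S y → S z → x ≢ y → y ≢ z → x ≢ z →
            extend x z ≼ extend x y + extend y z by Mid x y z
      tri {x} {y} {z} x∈ y∈ z∈ x≢y y≢z x≢z with x ≟ v | y ≟ v | z ≟ v
      ... | yes refl | yes refl | _        = contradiction refl x≢y
      ... | yes refl | no _     | yes refl = contradiction refl x≢z
      ... | no _     | yes refl | yes refl = contradiction refl y≢z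
      ... | yes refl | no p     | no q     = outer (S⇒T y∈ p) (S⇒T z∈ q) p q y≢z
      ... | no p     | yes refl | no q     = inner (S⇒T x∈ p) (S⇒T z∈ q) p q x≢z
      ... | no p     | no q     | yes refl
        rewrite d-sym x y | +-comm (suc k * d y x) (f y) =
        Sum.map₂ (λ (eq , m) → eq , Mid-sym m) (outer (S⇒T y∈ q) (S⇒T x∈ p) q p (≢-sym x≢y))
      ... | no p     | no q     | no r     =
        ≼-scale k (d x y) (d y z) (triangle (S⇒T x∈ p) (S⇒T y∈ q) (S⇒T z∈ r) x≢y y≢z x≢z)

      line-v : ∀ {z w} → S z → S w → z ≢ v → w ≢ v → z ≢ w → Edge v z w → Line extend v z w
      line-v {z} {w} z∈ w∈ z≢v w≢v z≢w e with v ≟ v | z ≟ v | w ≟ v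
      ... | no v≢v | _      | _      = contradiction refl v≢v
      ... | yes _  | yes eq | _      = contradiction eq z≢v
      ... | yes _  | no _   | yes eq = contradiction eq w≢v
      ... | yes _  | no _   | no _   = collinear (S⇒T z∈ z≢v) (S⇒T w∈ w≢v) z≢v w≢v z≢w e

      line-old : ∀ {x y z} → x ≢ v → y ≢ v → z ≢ v → Line d x y z → Line extend x y z
      line-old {x} {y} {z} x≢v y≢v z≢v l with x ≟ v | y ≟ v | z ≟ v
      ... | yes eq | _      | _      = contradiction eq x≢v
      ... | no _   | yes eq | _      = contradiction eq y≢v
      ... | no _   | no _   | yes eq = contradiction eq z≢v
      ... | no _   | no _   | no _   = Sum.map (scale (d x y) (d y z)) (Sum.map (scale (d y x) (d x z)) (scale (d x z) (d z y))) l
        where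
        scale : ∀ b c {a} → a ≡ b + c → suc k * a ≡ suc k * b + suc k * c
        scale b c refl = *-distribˡ-+ (suc k) b c

      ln : ∀ {x y z} → S x → S y → S z → x ≢ y → y ≢ z → x ≢ z →
           Edge x y z → Line extend x y z
      ln {x} {y} {z} x∈ y∈ z∈ x≢y y≢z x≢z e = go (x ≟ v) (y ≟ v) (z ≟ v)
        where
        go : Dec (x ≡ v) → Dec (y ≡ v) → Dec (z ≡ v) → Line extend x y z
        go (yes refl) _          _          =
          line-v y∈ z∈ (≢-sym x≢y) (≢-sym x≢z) y≢z e
        go (no x≢v)   (yes refl) _          =
          Line-swap₁₂ extend-sym y x z (line-v x∈ z∈ x≢v (≢-sym y≢z) x≢z (swap₁₂ e))
        go (no x≢v)   (no y≢v)   (yes refl) =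
          Line-swap₂₃ extend-sym x z y (Line-swap₁₂ extend-sym z x y (line-v x∈ y∈ x≢v y≢v x≢y (swap₁₂ (swap₂₃ e))))
        go (no x≢v)   (no y≢v)   (no z≢v)   = line-old x≢v y≢v z≢v
          (line (S⇒T x∈ x≢v) (S⇒T y∈ y≢v) (S⇒T z∈ z≢v) x≢y y≢z x≢z e)

  -- The right side holds one more copy of `c` than `a ≤ b + c` scaled by `k` would; that copy gives
  -- strictness.
  lipschitz : ∀ k a b {c} → a ≤ b + c → 0 < c → k * a < k * b + suc k * c
  lipschitz k a b {c} a≤b+c 0<c = begin-strict
    k * a              ≤⟨ *-monoʳ-≤ k a≤b+c ⟩
    k * (b + c)        ≡⟨ *-distribˡ-+ k b c ⟩
    k * b + k * c      <⟨ +-monoʳ-< (k * b) (m<n+m (k * c) 0<c) ⟩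
    k * b + suc k * c  ∎

  -- For natural numbers a strict inequality has slack at least 1, which scaling enlarges to
  -- `suc k`.
  scaled-gap : ∀ k a b c → a < b + c → suc k * a + suc k ≤ suc k * b + suc k * c
  scaled-gap k a b c a<b+c = begin
    suc k * a + suc k      ≡⟨ +-comm (suc k * a) (suc k) ⟩
    suc k + suc k * a      ≡⟨ *-suc (suc k) a ⟨
    suc k * suc a          ≤⟨ *-monoʳ-≤ (suc k) a<b+c ⟩
    suc k * (b + c)        ≡⟨ *-distribˡ-+ (suc k) b c ⟩
    suc k * b + suc k * c  ∎

  module _ {S T : Fin n → Set} {d : Fin n → Fin n → ℕ} (R : Realization T d)
    (v : Fin n) (S⇒T : ∀ {x} → S x → x ≢ v → T x) where
    open Realization R

    -- Every old point gets the same distance from `v`, larger than all old distances; as these are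
    -- positive, each triangle at `v` is strict. Taking `k = 0` keeps the old distances.
    add-isolated : (∀ {z w} → T z → T w → z ≢ v → w ≢ v → z ≢ w → ¬ Edge v z w) →
                   ∃ λ d′ → Realization S d′
    add-isolated isolated with dominated₂ d
    ... | M , d≤M = _ , realization-extend R v S⇒T 0 (λ _ → suc M)
      (λ _ → z<s)
      (λ {z} {w} z∈ w∈ _ _ z≢w → inj₁ (m<m+n (suc M) (<-≤-trans (d-pos z∈ w∈ z≢w) (m≤m+n (d z w) 0))))
      (λ {z} {w} _ _ _ _ _ → inj₁ (begin-strict
        d z w + 0     ≡⟨ +-identityʳ (d z w) ⟩
        d z w         ≤⟨ d≤M z w ⟩
        M             <⟨ n<1+n M ⟩
        suc M         ≤⟨ m≤m+n (suc M) (suc M) ⟩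
        suc M + suc M ∎))
      (λ z∈ w∈ z≢v w≢v z≢w e → contradiction e (isolated z∈ w∈ z≢v w≢v z≢w))

    module _ {x y : Fin n} (x∈ : T x) (y∈ : T y) (x≢v : x ≢ v) (y≢v : y ≢ v) (x≢y : x ≢ y)
      (e : Edge v x y)
      (only : ∀ {z w} → T z → T w → z ≢ v → w ≢ v → z ≢ w → Edge v z w →
              (z ≡ x × w ≡ y) ⊎ (z ≡ y × w ≡ x)) where

      private
        M : ℕ
        M = suc (proj₁ (dominated₂ d))

        d≤M : ∀ z w → d z w ≤ M
        d≤M z w = ≤-trans (proj₂ (dominated₂ d) z w) (n≤1+n _)

        -- The slack `suc k` has to exceed `M` in `add-beyond` and `s + M`, that is three times `M`,
        -- in `add-between`.
        k : ℕ
        k = 4 * M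

        M≤k : M ≤ k
        M≤k = m≤m+n M _

        -- If `z` were between `x` and `y`, the pair `xy` would be private to the edge through `z`,
        -- yet it also lies in the edge through `v`.
        not-between : ∀ {z} → z ≢ v → ¬ Mid x z y
        not-between z≢v (_ , private′) =
          z≢v (sym (private′ v (≢-sym x≢v) (≢-sym y≢v) (swap₁₂ e)))

      -- v is placed at distance t from x, with t so large that v is never between two points.  The
      -- distances from x to the points other than y are scaled by k rather than suc k, which makes
      -- f strictly 1-Lipschitz except on the pair x, y.
      add-beyond : Private v x y → ∃ λ d′ → Realization S d′
      add-beyond private-vy = _ , realization-extend R v S⇒T k f
        (λ {z} _ → <-≤-trans z<s (t≤f z)) outer inner collinear
        where
        t : ℕ
        t = suc k * M

        f : Fin n → ℕ
        f z with z ≟ y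
        ... | yes _ = t + suc k * d x y
        ... | no _  = t + k * d x z

        t≤f : ∀ z → t ≤ f z
        t≤f z with z ≟ y
        ... | yes _ = m≤m+n t _
        ... | no _  = m≤m+n t _

        f-x : f x ≡ t
        f-x with x ≟ y
        ... | yes eq = contradiction eq x≢y
        ... | no _   = trans (cong (λ a → t + k * a) (d-refl x))
                             (trans (cong (t +_) (*-zeroʳ k)) (+-identityʳ t))

        f-y : f y ≡ t + suc k * d x y
        f-y with y ≟ y
        ... | yes _  = refl
        ... | no y≢y = contradiction refl y≢y

        fy≡fx+ : f y ≡ f x + suc k * d x y
        fy≡fx+ = trans f-y (cong (_+ suc k * d x y) (sym f-x))

        shift : ∀ {a b c} → a < b + c → t + a < t + b + c
        shift {a} {b} {c} a<b+c =
          <-≤-trans (+-monoʳ-< t a<b+c) (≤-reflexive (sym (+-assoc t b c)))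

        outer : ∀ {z w} → T z → T w → z ≢ v → w ≢ v → z ≢ w → f w ≼ f z + suc k * d z w by Mid v z w
        outer {z} {w} z∈ w∈ z≢v w≢v z≢w = go (z ≟ x) (w ≟ y)
          where
          go : Dec (z ≡ x) → Dec (w ≡ y) → f w ≼ f z + suc k * d z w by Mid v z w
          -- The only equality: `x` lies between `v` and `y`, and the long side `vy` is private by
          -- hypothesis.
          go (yes refl) (yes refl) = inj₂ (fy≡fx+ , e , private-vy)
          go (no z≢x)   (yes refl) = inj₁ slope
            where
            slope : f y < f z + suc k * d z y
            slope rewrite f-y with z ≟ y
            ... | yes z≡y = contradiction z≡y z≢w
            -- Adding `d x z` turns `k * d x z` into a full multiple of `suc k`. Since `z` is not
            -- between `x` and `y`, the slack `suc k` absorbs the added `d x z ≤ M ≤ k`.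
            ... | no z≢y  = shift (+-cancelˡ-< (d x z) _ _ (begin-strict
              d x z + suc k * d x y                ≤⟨ +-monoˡ-≤ _ (≤-trans (d≤M x z) M≤k) ⟩
              k + suc k * d x y                    <⟨ ≤-refl ⟩
              suc k + suc k * d x y                ≡⟨ +-comm (suc k) _ ⟩
              suc k * d x y + suc k                ≤⟨ scaled-gap k (d x y) (d x z) (d z y)
                                                        (≼-strict (not-between z≢v) (triangle x∈ z∈ y∈ (≢-sym z≢x) z≢y x≢y)) ⟩
              suc k * d x z + suc k * d z y        ≡⟨ +-assoc (d x z) (k * d x z) _ ⟩
              d x z + (k * d x z + suc k * d z y)  ∎))
          go _          (no w≢y)   = inj₁ slope
            where
            bound : k * d x w < k * d x z + suc k * d z w
            bound = lipschitz k (d x w) (d x z) (Δ x∈ z∈ w∈) (d-pos z∈ w∈ z≢w)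

            slope : f w < f z + suc k * d z w
            slope with w ≟ y | z ≟ y
            ... | yes w≡y | _        = contradiction w≡y w≢y
            ... | no _    | no _     = shift bound
            -- At `z = y` the larger factor in `f` only increases the right side.
            ... | no _    | yes refl = shift (<-≤-trans bound (+-monoˡ-≤ _ (m≤n+m (k * d x y) (d x y))))

        inner : ∀ {z w} → T z → T w → z ≢ v → w ≢ v → z ≢ w → suc k * d z w ≼ f z + f w by Mid z v w
        -- `t` bounds every scaled old distance, so two legs at `v` always exceed the third side.
        inner {z} {w} _ _ _ _ _ = inj₁ (begin-strict
          suc k * d z w ≤⟨ *-monoʳ-≤ (suc k) (d≤M z w) ⟩
          t             ≤⟨ t≤f z ⟩
          f z           <⟨ m<m+n (f z) (<-≤-trans z<s (t≤f w)) ⟩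
          f z + f w     ∎)

        collinear : ∀ {z w} → T z → T w → z ≢ v → w ≢ v → z ≢ w → Edge v z w →
          f w ≡ f z + suc k * d z w ⊎ (suc k * d z w ≡ f z + f w ⊎ f z ≡ f w + suc k * d w z)
        collinear z∈ w∈ z≢v w≢v z≢w e′ with only z∈ w∈ z≢v w≢v z≢w e′
        ... | inj₁ (refl , refl) = inj₁ fy≡fx+
        ... | inj₂ (refl , refl) = inj₂ (inj₂ fy≡fx+)

      -- v is placed very close to x: at distance s from x, and at M + k * d x z from every z other than x and y;
      -- the factor k in place of suc k again makes f strictly 1-Lipschitz away from x and y.
      add-between : Private x v y → ∃ λ d′ → Realization S d′
      add-between private-xy = _ , realization-extend R v S⇒T k f
        (λ {z} _ → f-pos z) outer inner collinear
        where
        s : ℕ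
        s = M + M

        D : ℕ
        D = d x y

        -- What remains of the scaled side `xy`; the truncated subtraction is exact because
        -- `s < suc k ≤ suc k * D`.
        h : ℕ
        h = suc k * D ∸ s

        f : Fin n → ℕ
        f z with z ≟ x | z ≟ y
        ... | yes _ | _     = s
        ... | no _  | yes _ = h
        ... | no _  | no _  = M + k * d x z

        f-x : f x ≡ s
        f-x with x ≟ x
        ... | yes _  = refl
        ... | no x≢x = contradiction refl x≢x

        f-y : f y ≡ h
        f-y with y ≟ x | y ≟ y
        ... | yes eq | _      = contradiction (sym eq) x≢y
        ... | no _   | yes _  = refl
        ... | no _   | no y≢y = contradiction refl y≢y

        f-other : ∀ {z} → z ≢ x → z ≢ y → f z ≡ M + k * d x z
        f-other {z} z≢x z≢y with z ≟ x | z ≟ y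
        ... | yes eq | _      = contradiction eq z≢x
        ... | no _   | yes eq = contradiction eq z≢y
        ... | no _   | no _   = refl

        s<suck : s + M < suc k
        s<suck = s≤s (begin
          s + M ≤⟨ +-monoʳ-≤ s (m≤m+n M _) ⟩
          s + (M + (M + 0)) ≡⟨ +-assoc M M _ ⟩
          k ∎)

        suck≤ : ∀ {a} → 0 < a → suc k ≤ suc k * a
        suck≤ {a} 0<a = ≤-trans (≤-reflexive (sym (*-identityʳ (suc k)))) (*-monoʳ-≤ (suc k) 0<a)

        0<D : 0 < D
        0<D = d-pos x∈ y∈ x≢y

        s<KD : s < suc k * D
        s<KD = <-≤-trans (≤-<-trans (m≤m+n s M) s<suck) (suck≤ 0<D)

        s+h : s + h ≡ suc k * D
        s+h = m+[n∸m]≡n (<⇒≤ s<KD)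

        f-pos : ∀ z → 0 < f z
        f-pos z with z ≟ x | z ≟ y
        ... | yes _ | _     = z<s
        ... | no _  | yes _ = m<n⇒0<n∸m s<KD
        ... | no _  | no _  = z<s

        -- The pair `xy` is private to the edge through `v`, so a triangle on `x`, `y` and a third
        -- old point is strict in all directions.
        off-line : ∀ {z} → z ≢ v → z ≢ x → z ≢ y → ¬ Edge x z y
        off-line z≢v z≢x z≢y e′ = z≢v (private-xy _ z≢x z≢y e′)

        outer : ∀ {z w} → T z → T w → z ≢ v → w ≢ v → z ≢ w → f w ≼ f z + suc k * d z w by Mid v z w
        outer {z} {w} z∈ w∈ z≢v w≢v z≢w = inj₁ (go (z ≟ x) (z ≟ y) (w ≟ x) (w ≟ y))
          where
          go : Dec (z ≡ x) → Dec (z ≡ y) → Dec (w ≡ x) → Dec (w ≡ y) → f w < f z + suc k * d z w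
          go (yes refl) _ (yes refl) _ = contradiction refl z≢w
          go _ (yes refl) _ (yes refl) = contradiction refl z≢w
          go (yes refl) _ _ (yes refl) rewrite f-x | f-y =
            ≤-<-trans (m∸n≤m (suc k * D) s) (m<n+m (suc k * D) {s} z<s)
          go (yes refl) _ (no w≢x) (no w≢y) rewrite f-x | f-other w≢x w≢y =
            +-mono-<-≤ (m<m+n M z<s) (m≤n+m (k * d x w) (d x w))
          go _ (yes refl) (yes refl) _ rewrite f-x | f-y | d-sym y x =
            <-≤-trans s<KD (m≤n+m (suc k * D) h)
          go (no _) (yes refl) (no w≢x) (no w≢y) rewrite f-y | f-other w≢x w≢y =
            -- Adding `s` completes `h` to `suc k * D`; the slack of the strict triangle on `x`,
            -- `y`, `w` then covers `s + M`.
            +-cancelˡ-< s _ _ (begin-strict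
              s + (M + k * d x w)            ≡⟨ +-assoc s M _ ⟨
              s + M + k * d x w              <⟨ +-mono-<-≤ s<suck (m≤n+m (k * d x w) (d x w)) ⟩
              suc k + suc k * d x w          ≡⟨ +-comm (suc k) _ ⟩
              suc k * d x w + suc k          ≤⟨ scaled-gap k (d x w) D (d y w)
                (≼-strict (off-line w≢v w≢x w≢y ∘ swap₂₃ ∘ proj₁) (triangle x∈ y∈ w∈ x≢y z≢w (≢-sym w≢x))) ⟩
              suc k * D + suc k * d y w      ≡⟨ cong (_+ suc k * d y w) s+h ⟨
              s + h + suc k * d y w          ≡⟨ +-assoc s h _ ⟩
              s + (h + suc k * d y w)        ∎)
          go (no z≢x) (no z≢y) (yes refl) _ rewrite f-x | f-other z≢x z≢y = begin-strict
              M + M                           <⟨ +-monoʳ-< M (s≤s (m≤m+n _ _)) ⟩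
              M + suc k                       ≤⟨ +-mono-≤ (m≤m+n M (k * d x z)) (suck≤ (d-pos z∈ w∈ z≢w)) ⟩
              M + k * d x z + suc k * d z x   ∎
          go (no z≢x) (no z≢y) (no _) (yes refl) rewrite f-y | f-other z≢x z≢y = begin-strict
              h                                ≤⟨ m∸n≤m (suc k * D) s ⟩
              suc k * D                        <⟨ m<m+n _ z<s ⟩
              suc k * D + suc k                ≤⟨ scaled-gap k D (d x z) (d z y)
                (≼-strict (off-line z≢v z≢x z≢y ∘ proj₁) (triangle x∈ z∈ y∈ (≢-sym z≢x) z≢y x≢y)) ⟩
              -- The summand `M` of `f z` replaces the copy of `d x z` that the factor `k` lacks.
              suc k * d x z + suc k * d z y    ≤⟨ +-monoˡ-≤ _ (+-monoˡ-≤ _ (d≤M x z)) ⟩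
              M + k * d x z + suc k * d z y    ∎
          go (no z≢x) (no z≢y) (no w≢x) (no w≢y) rewrite f-other z≢x z≢y | f-other w≢x w≢y = begin-strict
              M + k * d x w                    <⟨ +-monoʳ-< M (lipschitz k (d x w) (d x z) (Δ x∈ z∈ w∈) (d-pos z∈ w∈ z≢w)) ⟩
              M + (k * d x z + suc k * d z w)  ≡⟨ +-assoc M _ _ ⟨
              M + k * d x z + suc k * d z w    ∎

        via-x : ∀ {w} → w ≢ x → w ≢ y → suc k * d x w < f x + f w
        via-x {w} w≢x w≢y rewrite f-x | f-other w≢x w≢y = begin-strict
          d x w + k * d x w         ≤⟨ +-monoˡ-≤ _ (d≤M x w) ⟩
          M + k * d x w             <⟨ m<n+m _ z<s ⟩
          s + (M + k * d x w)       ∎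

        -- As `x` is not between `y` and `w`, that triangle has slack `suc k`, more than the `s` by
        -- which `h` falls short of `suc k * D`.
        via-y : ∀ {w} → T w → w ≢ v → w ≢ x → w ≢ y → suc k * d y w < f y + f w
        via-y {w} w∈ w≢v w≢x w≢y rewrite f-y | f-other w≢x w≢y = +-cancelˡ-< (suc k) _ _ (begin-strict
          suc k + suc k * d y w            ≡⟨ +-comm (suc k) _ ⟩
          suc k * d y w + suc k            ≤⟨ scaled-gap k (d y w) D (d x w) gap ⟩
          suc k * D + suc k * d x w        ≤⟨ +-monoʳ-≤ _ (+-monoˡ-≤ _ (d≤M x w)) ⟩
          suc k * D + (M + k * d x w)      ≡⟨ cong (_+ (M + k * d x w)) s+h ⟨
          s + h + (M + k * d x w)          ≡⟨ +-assoc s h _ ⟩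
          s + (h + (M + k * d x w))        <⟨ +-monoˡ-< _ (≤-<-trans (m≤m+n s M) s<suck) ⟩
          suc k + (h + (M + k * d x w))    ∎)
          where
          gap : d y w < D + d x w
          gap = <-≤-trans
            (≼-strict (off-line w≢v w≢x w≢y ∘ swap₂₃ ∘ swap₁₂ ∘ proj₁)
              (triangle y∈ x∈ w∈ (≢-sym x≢y) (≢-sym w≢x) (≢-sym w≢y)))
            (≤-reflexive (cong (_+ d x w) (d-sym y x)))

        through-v : suc k * d x y ≡ f x + f y
        through-v = trans (sym s+h) (sym (cong₂ _+_ f-x f-y))

        through-v′ : suc k * d y x ≡ f y + f x
        through-v′ = trans (cong (suc k *_) (d-sym y x)) (trans through-v (+-comm (f x) (f y)))

        Mid-xvy : Mid x v y
        Mid-xvy = swap₁₂ e , private-xy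

        flip : ∀ {z w} → suc k * d w z < f w + f z → suc k * d z w < f z + f w
        flip {z} {w} lt rewrite d-sym z w | +-comm (f z) (f w) = lt

        inner : ∀ {z w} → T z → T w → z ≢ v → w ≢ v → z ≢ w → suc k * d z w ≼ f z + f w by Mid z v w
        inner {z} {w} z∈ w∈ z≢v w≢v z≢w = go (z ≟ x) (z ≟ y) (w ≟ x) (w ≟ y)
          where
          go : Dec (z ≡ x) → Dec (z ≡ y) → Dec (w ≡ x) → Dec (w ≡ y) →
               suc k * d z w ≼ f z + f w by Mid z v w
          go (yes refl) _ (yes refl) _ = contradiction refl z≢w
          go _ (yes refl) _ (yes refl) = contradiction refl z≢w
          go (yes refl) _ _ (yes refl) = inj₂ (through-v , Mid-xvy)
          go _ (yes refl) (yes refl) _ = inj₂ (through-v′ , Mid-sym Mid-xvy)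
          go (yes refl) _ (no w≢x) (no w≢y) = inj₁ (via-x w≢x w≢y)
          go (no z≢x) (no z≢y) (yes refl) _ = inj₁ (flip (via-x z≢x z≢y))
          go (no _) (yes refl) (no w≢x) (no w≢y) = inj₁ (via-y w∈ w≢v w≢x w≢y)
          go (no z≢x) (no z≢y) (no _) (yes refl) = inj₁ (flip (via-y z∈ z≢v z≢x z≢y))
          -- Comparison with the route through `x`: one `M` in `f z + f w` covers the extra copy of
          -- `d z w`, the other gives strictness.
          go (no z≢x) (no z≢y) (no w≢x) (no w≢y) = inj₁ far
            where
            far : suc k * d z w < f z + f w
            far rewrite f-other z≢x z≢y | f-other w≢x w≢y = begin-strict
              d z w + k * d z w                      ≤⟨ +-mono-≤ (d≤M z w) (*-monoʳ-≤ k (Δ z∈ x∈ w∈)) ⟩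
              M + k * (d z x + d x w)                ≡⟨ cong (λ a → M + k * (a + d x w)) (d-sym z x) ⟩
              M + k * (d x z + d x w)                ≡⟨ cong (M +_) (*-distribˡ-+ k (d x z) (d x w)) ⟩
              M + (k * d x z + k * d x w)            ≡⟨ +-assoc M _ _ ⟨
              M + k * d x z + k * d x w              <⟨ +-monoʳ-< (M + k * d x z) (m<n+m (k * d x w) {M} z<s) ⟩
              M + k * d x z + (M + k * d x w)        ∎

        collinear : ∀ {z w} → T z → T w → z ≢ v → w ≢ v → z ≢ w → Edge v z w →
          f w ≡ f z + suc k * d z w ⊎ (suc k * d z w ≡ f z + f w ⊎ f z ≡ f w + suc k * d w z)
        collinear z∈ w∈ z≢v w≢v z≢w e′ with only z∈ w∈ z≢v w≢v z≢w e′
        ... | inj₁ (refl , refl) = inj₂ (inj₁ through-v)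
        ... | inj₂ (refl , refl) = inj₂ (inj₁ through-v′)

-- Cardinalities of finite subsets, and triples.

∣p∪q∣≤∣p∣+∣q∣ : ∀ (p q : Subset n) → ∣ p ∪ q ∣ ≤ ∣ p ∣ + ∣ q ∣
∣p∪q∣≤∣p∣+∣q∣ []            []            = z≤n
∣p∪q∣≤∣p∣+∣q∣ (outside ∷ p) (outside ∷ q) = ∣p∪q∣≤∣p∣+∣q∣ p q
∣p∪q∣≤∣p∣+∣q∣ (outside ∷ p) (inside ∷ q)  =
  ≤-trans (s≤s (∣p∪q∣≤∣p∣+∣q∣ p q)) (≤-reflexive (sym (+-suc ∣ p ∣ ∣ q ∣)))
∣p∪q∣≤∣p∣+∣q∣ (inside ∷ p)  (outside ∷ q) = s≤s (∣p∪q∣≤∣p∣+∣q∣ p q)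
∣p∪q∣≤∣p∣+∣q∣ (inside ∷ p)  (inside ∷ q)  =
  s≤s (≤-trans (∣p∪q∣≤∣p∣+∣q∣ p q) (+-monoʳ-≤ ∣ p ∣ (n≤1+n ∣ q ∣)))

x∈p⇒∣p∣≡1+∣p-x∣ : ∀ {x} {p : Subset n} → x ∈ p → ∣ p ∣ ≡ suc ∣ p - x ∣
x∈p⇒∣p∣≡1+∣p-x∣ {p = inside ∷ p}  here      = cong (suc ∘ ∣_∣) (sym (p─⊥≡p p))
x∈p⇒∣p∣≡1+∣p-x∣ {p = inside ∷ p}  (there i) = cong suc (x∈p⇒∣p∣≡1+∣p-x∣ i)
x∈p⇒∣p∣≡1+∣p-x∣ {p = outside ∷ p} (there i) = x∈p⇒∣p∣≡1+∣p-x∣ i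

x∉p-x : ∀ x (p : Subset n) → x ∉ p - x
x∉p-x zero    (s ∷ p) ()
x∉p-x (suc x) (s ∷ p) (there i) = x∉p-x x p i

x∈p-y⇒x≢y : ∀ {x y} (p : Subset n) → x ∈ p - y → x ≢ y
x∈p-y⇒x≢y p i refl = x∉p-x _ p i

x∈p⇒p≡⁅x⁆∪p-x : ∀ {x} {p : Subset n} → x ∈ p → p ≡ ⁅ x ⁆ ∪ (p - x)
x∈p⇒p≡⁅x⁆∪p-x {x = x} {p} x∈p = ⊆-antisym to from
  where
  to : p ⊆ ⁅ x ⁆ ∪ (p - x)
  to {y} y∈p with y ≟ x
  ... | yes refl = x∈p∪q⁺ (inj₁ (x∈⁅x⁆ x))
  ... | no y≢x   = x∈p∪q⁺ (inj₂ (x∈p∧x≢y⇒x∈p-y y∈p y≢x))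

  from : ⁅ x ⁆ ∪ (p - x) ⊆ p
  from y∈ with x∈p∪q⁻ ⁅ x ⁆ (p - x) y∈
  ... | inj₁ y∈⁅x⁆ rewrite x∈⁅y⁆⇒x≡y x y∈⁅x⁆ = x∈p
  ... | inj₂ y∈p-x = p─q⊆p p ⁅ x ⁆ y∈p-x

0<∣p∣⇒Nonempty : ∀ {p : Subset n} → 0 < ∣ p ∣ → Nonempty p
0<∣p∣⇒Nonempty {n} {p} 0<∣p∣ with nonempty? p
... | yes p≢∅ = p≢∅
... | no p≡∅  rewrite Empty-unique p≡∅ | ∣⊥∣≡0 n = contradiction 0<∣p∣ λ ()

p⊆q∧∣q∣≤∣p∣⇒p≡q : ∀ {p q : Subset n} → p ⊆ q → ∣ q ∣ ≤ ∣ p ∣ → p ≡ q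
p⊆q∧∣q∣≤∣p∣⇒p≡q {p = p} {q} p⊆q ∣q∣≤∣p∣ = ⊆-antisym p⊆q q⊆p
  where
  q⊆p : q ⊆ p
  q⊆p {x} x∈q with x ∈? p
  ... | yes x∈p = x∈p
  ... | no x∉p  = contradiction ∣q∣≤∣p∣ (<⇒≱ (p⊂q⇒∣p∣<∣q∣ (p⊆q , x , x∈q , x∉p)))

∣p∣≡1⇒p≡⁅x⁆ : ∀ {x} {p : Subset n} → x ∈ p → ∣ p ∣ ≡ 1 → p ≡ ⁅ x ⁆
∣p∣≡1⇒p≡⁅x⁆ {x = x} {p} x∈p ∣p∣≡1 = sym (p⊆q∧∣q∣≤∣p∣⇒p≡q ⁅x⁆⊆p
  (≤-reflexive (trans ∣p∣≡1 (sym (∣⁅x⁆∣≡1 x)))))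
  where
  ⁅x⁆⊆p : ⁅ x ⁆ ⊆ p
  ⁅x⁆⊆p y∈ rewrite x∈⁅y⁆⇒x≡y x y∈ = x∈p

-- The first point is prescribed, so that an edge at `v` can be written with `v` in front.
∣p∣≡3⇒p≡triple : ∀ {x} {p : Subset n} → x ∈ p → ∣ p ∣ ≡ 3 →
                 ∃₂ λ y z → Distinct3 x y z × p ≡ triple x y z
∣p∣≡3⇒p≡triple {x = x} {p} x∈p ∣p∣≡3
  with ∣p-x∣≡2 ← suc-injective (trans (sym (x∈p⇒∣p∣≡1+∣p-x∣ x∈p)) ∣p∣≡3)
  with y , y∈ ← 0<∣p∣⇒Nonempty (subst (0 <_) (sym ∣p-x∣≡2) (s≤s z≤n))
  with ∣p-x-y∣≡1 ← suc-injective (trans (sym (x∈p⇒∣p∣≡1+∣p-x∣ y∈)) ∣p-x∣≡2)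
  with z , z∈ ← 0<∣p∣⇒Nonempty (subst (0 <_) (sym ∣p-x-y∣≡1) (s≤s z≤n))
  = y , z
  , ( ≢-sym (x∈p-y⇒x≢y p y∈)
    , ≢-sym (x∈p-y⇒x≢y (p - x) z∈)
    , ≢-sym (x∈p-y⇒x≢y p (p─q⊆p (p - x) ⁅ y ⁆ z∈)))
  , trans (x∈p⇒p≡⁅x⁆∪p-x x∈p) (cong (⁅ x ⁆ ∪_)
      (trans (x∈p⇒p≡⁅x⁆∪p-x y∈) (cong (⁅ y ⁆ ∪_) (∣p∣≡1⇒p≡⁅x⁆ z∈ ∣p-x-y∣≡1))))

∈-triple⁻ : ∀ {u} (x y z : Fin n) → u ∈ triple x y z → u ≡ x ⊎ (u ≡ y ⊎ u ≡ z)
∈-triple⁻ x y z u∈ =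
  Sum.map (x∈⁅y⁆⇒x≡y x) (Sum.map (x∈⁅y⁆⇒x≡y y) (x∈⁅y⁆⇒x≡y z) ∘ x∈p∪q⁻ ⁅ y ⁆ ⁅ z ⁆)
    (x∈p∪q⁻ ⁅ x ⁆ _ u∈)

x∈triple : ∀ (x y z : Fin n) → x ∈ triple x y z
x∈triple x y z = x∈p∪q⁺ (inj₁ (x∈⁅x⁆ x))

y∈triple : ∀ (x y z : Fin n) → y ∈ triple x y z
y∈triple x y z = x∈p∪q⁺ (inj₂ (x∈p∪q⁺ (inj₁ (x∈⁅x⁆ y))))

z∈triple : ∀ (x y z : Fin n) → z ∈ triple x y z
z∈triple x y z = x∈p∪q⁺ (inj₂ (x∈p∪q⁺ (inj₂ (x∈⁅x⁆ z))))

triple⊆ : ∀ {x y z} {p : Subset n} → x ∈ p → y ∈ p → z ∈ p → triple x y z ⊆ p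
triple⊆ {x = x} {y} {z} x∈ y∈ z∈ u∈ with ∈-triple⁻ x y z u∈
... | inj₁ refl        = x∈
... | inj₂ (inj₁ refl) = y∈
... | inj₂ (inj₂ refl) = z∈

∉-triple : ∀ {u x y z : Fin n} → u ≢ x → u ≢ y → u ≢ z → u ∉ triple x y z
∉-triple u≢x u≢y u≢z = [ u≢x , [ u≢y , u≢z ]′ ]′ ∘ ∈-triple⁻ _ _ _

triple-swap₁₂ : ∀ (x y z : Fin n) → triple x y z ≡ triple y x z
triple-swap₁₂ x y z = ⊆-antisym
  (triple⊆ (y∈triple y x z) (x∈triple y x z) (z∈triple y x z))
  (triple⊆ (y∈triple x y z) (x∈triple x y z) (z∈triple x y z))

triple-swap₂₃ : ∀ (x y z : Fin n) → triple x y z ≡ triple x z y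
triple-swap₂₃ x y z = cong (⁅ x ⁆ ∪_) (∪-comm ⁅ y ⁆ ⁅ z ⁆)

-- Counting distinct elements and incidences.

-- The head is cut out of `ys`; by uniqueness the tail still embeds in what is left.
Unique-⊆⇒length≤ : ∀ {A : Set} {xs ys : List A} → Unique xs → (∀ {x} → x ∈ˡ xs → x ∈ˡ ys) →
                   length xs ≤ length ys
Unique-⊆⇒length≤ {xs = []}     _            _     = z≤n
Unique-⊆⇒length≤ {xs = x ∷ xs} (x∉xs ∷ xs!) xs⊆ys with ∈-∃++ (xs⊆ys (here refl))
... | as , bs , refl = ≤-trans (s≤s (Unique-⊆⇒length≤ xs! rest)) (≤-reflexive (sym length-split))
  where
  rest : ∀ {y} → y ∈ˡ xs → y ∈ˡ as ++ bs
  rest y∈xs with ∈-++⁻ as (xs⊆ys (there y∈xs))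
  ... | inj₁ y∈as         = ∈-++⁺ˡ y∈as
  ... | inj₂ (here refl)  = contradiction refl (All.lookup x∉xs y∈xs)
  ... | inj₂ (there y∈bs) = ∈-++⁺ʳ as y∈bs

  length-split : length (as ++ x ∷ bs) ≡ suc (length (as ++ bs))
  length-split = trans (List.length-++ as)
    (trans (+-suc (length as) (length bs)) (cong suc (sym (List.length-++ as))))

degree : List (Subset n) → Fin n → ℕ
degree es v = length (filter (v ∈?_) es)

degree-suc : ∀ (es : List (Subset (suc n))) v → degree es (suc v) ≡ degree (map tail es) v
degree-suc []             v = refl
degree-suc ((_ ∷ e) ∷ es) v with v ∈? e
... | yes _ = cong suc (degree-suc es v)
... | no _  = degree-suc es v

sum-sizes : ∀ (es : List (Subset (suc n))) →
            sum (map ∣_∣ es) ≡ degree es zero + sum (map ∣_∣ (map tail es))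
sum-sizes []                   = refl
sum-sizes ((outside ∷ e) ∷ es) rewrite sum-sizes es = x∙yz≈y∙xz ∣ e ∣ (degree es zero) _
sum-sizes ((inside ∷ e) ∷ es)  rewrite sum-sizes es = cong suc (x∙yz≈y∙xz ∣ e ∣ (degree es zero) _)

-- Double counting of incidences, by peeling the first vertex off all sets. Lists count with
-- multiplicity, so sets that become equal after peeling are still counted separately.
handshake : ∀ k (S : Subset n) es → (∀ {v} → v ∈ S → k ≤ degree es v) → k * ∣ S ∣ ≤ sum (map ∣_∣ es)
handshake k []      es k≤deg = ≤-trans (≤-reflexive (*-zeroʳ k)) z≤n
handshake k (s ∷ S) es k≤deg rewrite sum-sizes es
  with ih ← handshake k S (map tail es) (λ {v} v∈S → subst (k ≤_) (degree-suc es v) (k≤deg (there v∈S)))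
  with s
... | outside = ≤-trans ih (m≤n+m _ _)
... | inside  = ≤-trans (≤-reflexive (*-suc k ∣ S ∣)) (+-mono-≤ (k≤deg here) ih)

2⌈n/2⌉≤1+n : ∀ n → 2 * ⌈ n /2⌉ ≤ suc n
2⌈n/2⌉≤1+n n = begin
  2 * ⌈ n /2⌉              ≡⟨ cong (⌈ n /2⌉ +_) (+-identityʳ ⌈ n /2⌉) ⟩
  -- By definition `⌈ n /2⌉` is `⌊ suc n /2⌋`, and `suc ⌊ n /2⌋` is `⌊ suc (suc n) /2⌋`.
  ⌈ n /2⌉ + ⌈ n /2⌉        ≤⟨ +-monoˡ-≤ ⌈ n /2⌉ (⌊n/2⌋-mono (n≤1+n (suc n))) ⟩
  suc (⌊ n /2⌋ + ⌈ n /2⌉)  ≡⟨ cong suc (⌊n/2⌋+⌈n/2⌉≡n n) ⟩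
  suc n                    ∎

length≤1⇒≡ : ∀ {A : Set} {xs : List A} {x y} → length xs ≤ 1 → x ∈ˡ xs → y ∈ˡ xs → x ≡ y
length≤1⇒≡ {xs = _ ∷ []} _ (here refl) (here refl) = refl
length≤1⇒≡ {xs = _ ∷ _ ∷ _} (s≤s ())

sum-uniform : ∀ {k} {es : List (Subset n)} → All (λ e → ∣ e ∣ ≡ k) es → sum (map ∣_∣ es) ≡ length es * k
sum-uniform []         = refl
sum-uniform (eq ∷ eqs) = cong₂ _+_ eq (sum-uniform eqs)

-- Private pairs, low-degree vertices and the induction.

module SparseHypergraph {n : ℕ} (H : Hypergraph3 n) (sparse : Sparse f₀ H) where

  Edge : Fin n → Fin n → Fin n → Set
  Edge x y z = triple x y z ∈ˡ edges H

  swap₁₂ : ∀ {x y z} → Edge x y z → Edge y x z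
  swap₁₂ {x} {y} {z} = subst (_∈ˡ edges H) (triple-swap₁₂ x y z)

  swap₂₃ : ∀ {x y z} → Edge x y z → Edge x z y
  swap₂₃ {x} {y} {z} = subst (_∈ˡ edges H) (triple-swap₂₃ x y z)

  open Extension Edge swap₁₂ swap₂₃

  edge? : ∀ x y z → Dec (Edge x y z)
  edge? x y z = Any.any? (λ e → ≡-dec _≟ᵇ_ (triple x y z) e) (edges H)

  ∣edge∣≡3 : ∀ {e} → e ∈ˡ edges H → ∣ e ∣ ≡ 3
  ∣edge∣≡3 = All.lookup (uniform H)

  private-or-shared : ∀ x y z → Private x y z ⊎ ∃ λ w → w ≢ x × w ≢ z × Edge x w z × w ≢ y
  private-or-shared x y z
    with any? (λ w → ¬? (w ≟ x) ×-dec ¬? (w ≟ z) ×-dec edge? x w z ×-dec ¬? (w ≟ y))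
  ... | yes shared = inj₂ shared
  ... | no none    = inj₁ λ w w≢x w≢z e →
    decidable-stable (w ≟ y) λ w≢y → none (w , w≢x , w≢z , e , w≢y)

  -- If all three pairs are shared, the edge and one further edge on each pair lie in a set of 4 to
  -- 6 vertices, where at most 3 edges are allowed.
  private-pair : ∀ {a b c} → Distinct3 a b c → Edge a b c →
                 Private b a c ⊎ (Private a b c ⊎ Private a c b)
  private-pair {a} {b} {c} (a≢b , b≢c , a≢c) e₀
    with private-or-shared b a c | private-or-shared a b c | private-or-shared a c b
  ... | inj₁ p | _      | _      = inj₁ p
  ... | inj₂ _ | inj₁ p | _      = inj₂ (inj₁ p)
  ... | inj₂ _ | inj₂ _ | inj₁ p = inj₂ (inj₂ p)
  ... | inj₂ (u , _ , _ , e₁ , u≢a) | inj₂ (v , _ , _ , e₂ , v≢b) | inj₂ (w , _ , _ , e₃ , w≢c) =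
    contradiction (≤-trans 4≤edges (≤-trans (sparse T 4≤∣T∣) (⌈n/2⌉-mono ∣T∣≤6))) λ { (s≤s (s≤s (s≤s ()))) }
    where
    E₀ E₁ E₂ E₃ T : Subset n
    E₀ = triple a b c
    E₁ = triple b u c
    E₂ = triple a v c
    E₃ = triple a w b
    T = E₀ ∪ triple u v w

    a∉E₁ : a ∉ E₁
    a∉E₁ = ∉-triple a≢b (≢-sym u≢a) a≢c

    b∉E₂ : b ∉ E₂
    b∉E₂ = ∉-triple (≢-sym a≢b) (≢-sym v≢b) b≢c

    c∉E₃ : c ∉ E₃
    c∉E₃ = ∉-triple (≢-sym a≢c) (≢-sym w≢c) (≢-sym b≢c)

    separated : ∀ {x} {p q : Subset n} → x ∈ p → x ∉ q → p ≢ q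
    separated x∈p x∉q refl = x∉q x∈p

    distinct : Unique (E₀ ∷ E₁ ∷ E₂ ∷ E₃ ∷ [])
    -- Each further edge contains two of `a`, `b`, `c` and misses the third, a different one each
    -- time.
    distinct =
        (separated (x∈triple a b c) a∉E₁ ∷ separated (y∈triple a b c) b∉E₂ ∷ separated (z∈triple a b c) c∉E₃ ∷ [])
      ∷ (separated (x∈triple b u c) b∉E₂ ∷ separated (z∈triple b u c) c∉E₃ ∷ [])
      ∷ (separated (z∈triple a v c) c∉E₃ ∷ [])
      ∷ [] ∷ []

    E₀⊆T : E₀ ⊆ T
    E₀⊆T = p⊆p∪q (triple u v w)

    a∈ : a ∈ T
    a∈ = E₀⊆T (x∈triple a b c)

    b∈ : b ∈ T
    b∈ = E₀⊆T (y∈triple a b c)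

    c∈ : c ∈ T
    c∈ = E₀⊆T (z∈triple a b c)

    new⊆T : triple u v w ⊆ T
    new⊆T = q⊆p∪q E₀ (triple u v w)

    E₁⊆T : E₁ ⊆ T
    E₁⊆T = triple⊆ b∈ (new⊆T (x∈triple u v w)) c∈

    inside-T : ∀ {e} → e ∈ˡ edges H → e ⊆ T → e ∈ˡ filter (_⊆? T) (edges H)
    inside-T = ∈-filter⁺ (_⊆? T)

    4≤edges : 4 ≤ edgesIn H T
    4≤edges = Unique-⊆⇒length≤ distinct λ where
      (here refl)                         → inside-T e₀ E₀⊆T
      (there (here refl))                 → inside-T e₁ E₁⊆T
      (there (there (here refl)))         → inside-T e₂ (triple⊆ a∈ (new⊆T (y∈triple u v w)) c∈)
      (there (there (there (here refl)))) → inside-T e₃ (triple⊆ a∈ (new⊆T (z∈triple u v w)) b∈)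

    4≤∣T∣ : 4 ≤ ∣ T ∣
    -- Sparseness speaks only of sets of size at least 4; a smaller `T` would coincide with both
    -- `E₀` and `E₁`.
    4≤∣T∣ = ≰⇒> λ ∣T∣≤3 → separated (x∈triple a b c) a∉E₁
      (trans (p⊆q∧∣q∣≤∣p∣⇒p≡q E₀⊆T (subst (∣ T ∣ ≤_) (sym (∣edge∣≡3 e₀)) ∣T∣≤3))
        (sym (p⊆q∧∣q∣≤∣p∣⇒p≡q E₁⊆T (subst (∣ T ∣ ≤_) (sym (∣edge∣≡3 e₁)) ∣T∣≤3))))

    ∣new∣≤3 : ∣ triple u v w ∣ ≤ 3
    ∣new∣≤3 = ≤-trans (∣p∪q∣≤∣p∣+∣q∣ ⁅ u ⁆ _)
      (+-mono-≤ (≤-reflexive (∣⁅x⁆∣≡1 u)) (≤-trans (∣p∪q∣≤∣p∣+∣q∣ ⁅ v ⁆ ⁅ w ⁆)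
        (≤-reflexive (cong₂ _+_ (∣⁅x⁆∣≡1 v) (∣⁅x⁆∣≡1 w)))))

    ∣T∣≤6 : ∣ T ∣ ≤ 6
    ∣T∣≤6 = ≤-trans (∣p∪q∣≤∣p∣+∣q∣ E₀ _) (+-mono-≤ (≤-reflexive (∣edge∣≡3 e₀)) ∣new∣≤3)

  AtMostOneEdge : Subset n → Fin n → Set
  AtMostOneEdge S v = ∀ {e e′} → e ∈ˡ edges H → e′ ∈ˡ edges H → e ⊆ S → e′ ⊆ S → v ∈ e → v ∈ e′ → e ≡ e′

  -- If every degree inside `S` were at least 2, then `2 * ∣ S ∣ ≤ 3 * m` with `m ≤ ⌈ ∣ S ∣ /2⌉`,
  -- which forces `∣ S ∣ ≤ 3`.
  low-degree : ∀ S → Nonempty S → ∃ λ v → v ∈ S × AtMostOneEdge S v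
  low-degree S (v₀ , v₀∈S) with 4 ≤? ∣ S ∣
  -- With at most three vertices, the only possible edge inside `S` is `S` itself.
  ... | no ∣S∣≱4 = v₀ , v₀∈S , λ e∈ e′∈ e⊆S e′⊆S _ _ → trans (≡S e∈ e⊆S) (sym (≡S e′∈ e′⊆S))
    where
    ≡S : ∀ {e} → e ∈ˡ edges H → e ⊆ S → e ≡ S
    ≡S e∈ e⊆S = p⊆q∧∣q∣≤∣p∣⇒p≡q e⊆S (subst (∣ S ∣ ≤_) (sym (∣edge∣≡3 e∈)) (≤-pred (≰⇒> ∣S∣≱4)))
  ... | yes 4≤∣S∣ 
    with any? (λ v → v ∈? S ×-dec degree (filter (_⊆? S) (edges H)) v ≤? 1)
  ...   | yes (v , v∈S , deg≤1) = v , v∈S , λ e∈ e′∈ e⊆S e′⊆S v∈e v∈e′ →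
    length≤1⇒≡ deg≤1 (∈-filter⁺ (v ∈?_) (∈-filter⁺ (_⊆? S) e∈ e⊆S) v∈e)
                     (∈-filter⁺ (v ∈?_) (∈-filter⁺ (_⊆? S) e′∈ e′⊆S) v∈e′)
  ...   | no none = contradiction 4≤∣S∣ (<⇒≱ (s≤s ∣S∣≤3))
    where
    m : ℕ
    m = edgesIn H S

    2∣S∣≤3m : 2 * ∣ S ∣ ≤ m * 3
    2∣S∣≤3m = ≤-trans
      (handshake 2 S (filter (_⊆? S) (edges H)) (λ {v} v∈S → ≰⇒> λ deg≤1 → none (v , v∈S , deg≤1)))
      (≤-reflexive (sum-uniform (All.filter⁺ (_⊆? S) (uniform H))))

    ∣S∣≤3 : ∣ S ∣ ≤ 3
    ∣S∣≤3 = +-cancelʳ-≤ (3 * ∣ S ∣) _ _ (begin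
      4 * ∣ S ∣                 ≡⟨ *-assoc 2 2 ∣ S ∣ ⟩
      2 * (2 * ∣ S ∣)           ≤⟨ *-monoʳ-≤ 2 2∣S∣≤3m ⟩
      2 * (m * 3)               ≡⟨ *-assoc 2 m 3 ⟨
      2 * m * 3                 ≤⟨ *-monoˡ-≤ 3 (*-monoʳ-≤ 2 (sparse S 4≤∣S∣)) ⟩
      2 * ⌈ ∣ S ∣ /2⌉ * 3       ≤⟨ *-monoˡ-≤ 3 (2⌈n/2⌉≤1+n ∣ S ∣) ⟩
      3 + ∣ S ∣ * 3             ≡⟨ cong (3 +_) (*-comm ∣ S ∣ 3) ⟩
      3 + 3 * ∣ S ∣             ∎)

  -- Induction on the size of `S`: a vertex of low degree is removed, and is put back with
  -- `add-isolated` or according to its single edge.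
  realizable : ∀ k S → ∣ S ∣ ≡ k → ∃ λ d → Realization (_∈ S) d
  realizable zero S ∣S∣≡0 = (λ _ _ → 0) , record
    { d-sym    = λ _ _ → refl
    ; d-refl   = λ _ → refl
    ; d-pos    = λ x∈ → contradiction x∈ ∉S
    ; triangle = λ x∈ → contradiction x∈ ∉S
    ; line     = λ x∈ → contradiction x∈ ∉S
    }
    where
    ∉S : ∀ {x} → x ∉ S
    ∉S x∈S = 0≢1+n (trans (sym ∣S∣≡0) (x∈p⇒∣p∣≡1+∣p-x∣ x∈S))
  realizable (suc k) S ∣S∣≡1+k
    with v , v∈S , unique-at-v ← low-degree S (0<∣p∣⇒Nonempty (subst (0 <_) (sym ∣S∣≡1+k) (s≤s z≤n)))
    with d , R ← realizable k (S - v) (suc-injective (trans (sym (x∈p⇒∣p∣≡1+∣p-x∣ v∈S)) ∣S∣≡1+k))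
    with Any.any? (λ e → v ∈? e ×-dec e ⊆? S) (edges H)
  ... | no none = add-isolated R v x∈p∧x≢y⇒x∈p-y isolated
    where
    isolated : ∀ {z w} → z ∈ S - v → w ∈ S - v → z ≢ v → w ≢ v → z ≢ w → ¬ Edge v z w
    isolated {z} {w} z∈ w∈ _ _ _ e = none (lose e
      (x∈triple v z w , triple⊆ v∈S (p─q⊆p S ⁅ v ⁆ z∈) (p─q⊆p S ⁅ v ⁆ w∈)))
  ... | yes some
    with e , e∈ , v∈e , e⊆S ← find some
    with x , y , (v≢x , x≢y , v≢y) , refl ← ∣p∣≡3⇒p≡triple v∈e (∣edge∣≡3 e∈)
    = extended (private-pair (v≢x , x≢y , v≢y) e∈)
    where
    x∈ : x ∈ S - v
    x∈ = x∈p∧x≢y⇒x∈p-y (e⊆S (y∈triple v x y)) (≢-sym v≢x)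

    y∈ : y ∈ S - v
    y∈ = x∈p∧x≢y⇒x∈p-y (e⊆S (z∈triple v x y)) (≢-sym v≢y)

    only : ∀ {z w} → z ∈ S - v → w ∈ S - v → z ≢ v → w ≢ v → z ≢ w → Edge v z w →
           (z ≡ x × w ≡ y) ⊎ (z ≡ y × w ≡ x)
    only {z} {w} z∈ w∈ z≢v w≢v z≢w e′
      with same ← unique-at-v e′ e∈ (triple⊆ v∈S (p─q⊆p S ⁅ v ⁆ z∈) (p─q⊆p S ⁅ v ⁆ w∈)) e⊆S (x∈triple v z w) v∈e
      with ∈-triple⁻ v x y (subst (z ∈_) same (y∈triple v z w)) | ∈-triple⁻ v x y (subst (w ∈_) same (z∈triple v z w))
    ... | inj₁ z≡v         | _                = contradiction z≡v z≢v
    ... | _                | inj₁ w≡v         = contradiction w≡v w≢v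
    ... | inj₂ (inj₁ z≡x)  | inj₂ (inj₂ w≡y)  = inj₁ (z≡x , w≡y)
    ... | inj₂ (inj₂ z≡y)  | inj₂ (inj₁ w≡x)  = inj₂ (z≡y , w≡x)
    ... | inj₂ (inj₁ refl) | inj₂ (inj₁ refl) = contradiction refl z≢w
    ... | inj₂ (inj₂ refl) | inj₂ (inj₂ refl) = contradiction refl z≢w

    -- The private pair becomes the long side: `xy` puts `v` between, `vy` puts it beyond `x`, and
    -- `vx` beyond `y` with the roles exchanged.
    extended : Private x v y ⊎ (Private v x y ⊎ Private v y x) → ∃ λ d′ → Realization (_∈ S) d′
    extended (inj₁ p) =
      add-between R v x∈p∧x≢y⇒x∈p-y x∈ y∈ (≢-sym v≢x) (≢-sym v≢y) x≢y e∈ only p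
    extended (inj₂ (inj₁ p)) =
      add-beyond R v x∈p∧x≢y⇒x∈p-y x∈ y∈ (≢-sym v≢x) (≢-sym v≢y) x≢y e∈ only p
    extended (inj₂ (inj₂ p)) =
      add-beyond R v x∈p∧x≢y⇒x∈p-y y∈ x∈ (≢-sym v≢y) (≢-sym v≢x) (≢-sym x≢y) (swap₂₃ e∈)
        (λ z∈ w∈ z≢v w≢v z≢w → Sum.swap ∘ only z∈ w∈ z≢v w≢v z≢w) p

-- Passage to rational distances.

fromℕ : ℕ → ℚ
fromℕ m = mkℚ (ℤ.+ m) 0 (Coprime.sym (Coprime.1-coprimeTo m))

-- `fromℕ` is built in lowest terms, so the numerator recovers the number.
fromℕ-injective : ∀ {a b} → fromℕ a ≡ fromℕ b → a ≡ b
fromℕ-injective = ℤ.+-injective ∘ cong ℚ.numerator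

fromℕ-mono : ∀ {a b} → a ≤ b → fromℕ a ≤ℚ fromℕ b
fromℕ-mono a≤b = *≤* (ℤ.*-monoʳ-≤-nonNeg (ℤ.+ 1) (ℤ.+≤+ a≤b))

-- Rational addition normalises its result, so the equation is checked on unnormalised fractions by
-- cross-multiplication.
fromℕ-+ : ∀ a b → fromℕ (a + b) ≡ fromℕ a +ℚ fromℕ b
fromℕ-+ a b = toℚᵘ-injective (ℚᵘ.≃-trans
  (*≡* (cong (ℤ._* ℤ.+ 1) (sym (cong₂ ℤ._+_ (ℤ.*-identityʳ (ℤ.+ a)) (ℤ.*-identityʳ (ℤ.+ b))))))
  (ℚᵘ.≃-sym (toℚᵘ-homo-+ (fromℕ a) (fromℕ b))))

theorem2 : ∀ (n : ℕ) (H : Hypergraph3 n) → Sparse f₀ H → IsMetricHypergraph H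
theorem2 n H sparse = ρ , metric , realizes
  where
  open SparseHypergraph H sparse
  open Extension Edge swap₁₂ swap₂₃

  d : Fin n → Fin n → ℕ
  d = proj₁ (realizable n ⊤ (∣⊤∣≡n n))

  open Realization (proj₂ (realizable n ⊤ (∣⊤∣≡n n)))

  ρ : Fin n → Fin n → ℚ
  ρ x y = fromℕ (d x y)

  d≡0⇒≡ : ∀ x y → d x y ≡ 0 → x ≡ y
  d≡0⇒≡ x y d≡0 = decidable-stable (x ≟ y) λ x≢y → <⇒≢ (d-pos ∈⊤ ∈⊤ x≢y) (sym d≡0)

  metric : IsMetric ρ
  metric = record
    { nonneg   = λ x y → fromℕ-mono z≤n
    ; zero⇔eq  = λ x y → mk⇔ (λ eq → d≡0⇒≡ x y (fromℕ-injective eq)) λ { refl → cong fromℕ (d-refl x) }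
    ; symm     = λ x y → cong fromℕ (d-sym x y)
    ; triangle = λ x y z → subst (ρ x z ≤ℚ_) (fromℕ-+ (d x y) (d y z)) (fromℕ-mono (Δ ∈⊤ ∈⊤ ∈⊤))
    }

  between⁺ : ∀ x y z → d x z ≡ d x y + d y z → Between ρ x y z
  between⁺ x y z eq = trans (cong fromℕ eq) (fromℕ-+ (d x y) (d y z))

  -- Equality excludes the strict alternative of `triangle`; the other one contains the edge.
  between⇒edge : ∀ x y z → Distinct3 x y z → Between ρ x y z → Edge x y z
  between⇒edge x y z (x≢y , y≢z , x≢z) b with triangle ∈⊤ ∈⊤ ∈⊤ x≢y y≢z x≢z
  ... | inj₁ lt          = contradiction (fromℕ-injective (trans b (sym (fromℕ-+ (d x y) (d y z))))) (<⇒≢ lt)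
  ... | inj₂ (_ , e , _) = e

  realizes : Realizes ρ H
  realizes x y z distinct@(x≢y , y≢z , x≢z) = mk⇔
    (Sum.map (between⁺ x y z) (Sum.map (between⁺ y x z) (between⁺ x z y)) ∘ line ∈⊤ ∈⊤ ∈⊤ x≢y y≢z x≢z)
    [ between⇒edge x y z distinct
    , [ swap₁₂ ∘ between⇒edge y x z (≢-sym x≢y , x≢z , y≢z)
      , swap₂₃ ∘ between⇒edge x z y (x≢z , ≢-sym y≢z , x≢y) ]′ ]′
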